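{- Let $A=[a_{ij}]\in M_{m,n}(\mathbb{R})$ have rank $r>1$ and be diagonally eliminable up to $r$, and let $k$ be an integer with $0\leq k<r$. Then $A^{(2k)}=[a^{(2k)}_{ij}]$ has as its first $k$ columns the first $k$ columns of the $m\times m$ identity matrix (i.e. $a^{(2k)}_{ij}=\delta_{ij}$ for $1\leq j\leq k$), and for $k+1\leq j\leq n$, $$a^{(2k)}_{ij}=\begin{cases}(-1)^{k+i}\dfrac{m^{1\dots k}_{1\dots i-1,\,i+1\dots k,\,j}}{m_k} & \text{if } 1\leq i\leq k,\\[2mm] \dfrac{m^{1\dots k\, i}_{1\dots k\, j}}{m_k} & \text{if } k+1\leq i\leq m.\end{cases}$$
   Context: Gauss-Jordan procedure: for $A\in M_{m,n}(\mathbb{R})$ set $A^{(0)}=A$. For $k\geq 0$, if $A^{(2k)}=[a^{(2k)}_{ij}]$ is defined and $a^{(2k)}_{k+1,k+1}\neq 0$, let $\mathcal{G}_{2k+1}$ be the $m\times m$ diagonal matrix with all diagonal entries $1$ except the $(k+1,k+1)$ entry, which is $1/a^{(2k)}_{k+1,k+1}$, and set $A^{(2k+1)}=\mathcal{G}_{2k+1}A^{(2k)}=[a^{(2k+1)}_{ij}]$; then let $\mathcal{G}_{2k+2}=[g_{ij}]_{m\times m}$ with $g_{ii}=1$, $g_{i,k+1}=-a^{(2k+1)}_{i,k+1}$ for $i\neq k+1$, and all other entries $0$, and set $A^{(2k+2)}=\mathcal{G}_{2k+2}A^{(2k+1)}$. A matrix $A$ of rank $r\geq 1$ is diagonally eliminable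 up to $r$ if for each $k=1,\dots,r$ the matrix $A^{(2k-2)}$ is defined and $a^{(2k-2)}_{kk}\neq 0$. Minors: for $1\leq i_1<\dots<i_p\leq m$, $1\leq j_1<\dots<j_p\leq n$, $m^{i_1\dots i_p}_{j_1\dots j_p}$ is the determinant of the submatrix of $A$ with rows $i_1,\dots,i_p$ and columns $j_1,\dots,j_p$; thus $m^{1\dots k}_{1\dots i-1,\,i+1\dots k,\,j}$ uses rows $1,\dots,k$ and columns $1,\dots,k$ with $i$ removed and $j$ appended, and $m^{1\dots k\,i}_{1\dots k\,j}$ uses rows $1,\dots,k,i$ and columns $1,\dots,k,j$. $m_k=m^{1\dots k}_{1\dots k}$ and $m_0=1$. -}

module Defs where

open import Level using (_⊔_) renaming (suc to lsuc)
open import Algebra.Apartness.Bundles using (HeytingField; HeytingCommutativeRing)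
open import Algebra.Bundles using (CommutativeRing; Semiring)
import Algebra.Definitions.RawSemiring as RawSemiringDefinitions
import Algebra.Properties.Ring as RingProperties
open import Data.Bool.Base using (if_then_else_)
open import Data.Fin.Base using (Fin; zero; suc; toℕ; fromℕ; fromℕ<; inject≤; punchIn)
open import Data.Fin.Properties using (_≟_)
open import Data.Nat.Base as ℕ using (ℕ; zero; suc)
open import Data.Nat.Properties using (<⇒≤)
open import Data.Product.Base using (Σ-syntax; ∃-syntax; _×_; _,_; proj₁; proj₂)
open import Data.Sum.Base using (_⊎_)
open import Data.Unit.Polymorphic.Base using (⊤)
open import Data.Vec.Functional using (Vector; insertAt)
open import Relation.Binary.Core using (Rel)
open import Relation.Binary.Structures using (IsStrictPartialOrder)
open import Relation.Nullary.Decidable.Core using (does)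

-- The real numbers, axiomatically: a Cauchy-complete Archimedean ordered field.
-- Classically this determines ℝ up to unique isomorphism.  The constructive
-- form of "x ≠ y" for reals is the apartness x # y; it is tight, so ¬ (x # y)
-- is the same as x ≈ y, and classically x # y is the same as ¬ (x ≈ y).
record RealNumbers c ℓ₁ ℓ₂ ℓ₃ : Set (lsuc (c ⊔ ℓ₁ ⊔ ℓ₂ ⊔ ℓ₃)) where
  infix 4 _<_
  field
    heytingField : HeytingField c ℓ₁ ℓ₂

  open HeytingField heytingField public
  open RawSemiringDefinitions
    (Semiring.rawSemiring (CommutativeRing.semiring
      (HeytingCommutativeRing.commutativeRing heytingCommutativeRing)))
    using () renaming (_×_ to _·_)

  field
    _<_                  : Rel Carrier ℓ₃
    isStrictPartialOrder : IsStrictPartialOrder _≈_ _<_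
    #⇒<⊎>                : ∀ {x y} → x # y → x < y ⊎ y < x
    <⇒#                  : ∀ {x y} → x < y → x # y
    +-monoˡ-<            : ∀ {x y} z → x < y → x + z < y + z
    *-positive           : ∀ {x y} → 0# < x → 0# < y → 0# < x * y
    archimedean          : ∀ x → ∃[ n ] x < n · 1#

  -- | x - y | < ε
  Within : Carrier → Carrier → Carrier → Set ℓ₃
  Within ε x y = (x - y < ε) × (y - x < ε)

  IsCauchy : (ℕ → Carrier) → Set (c ⊔ ℓ₃)
  IsCauchy s = ∀ ε → 0# < ε →
    ∃[ N ] (∀ p q → N ℕ.≤ p → N ℕ.≤ q → Within ε (s p) (s q))

  ConvergesTo : (ℕ → Carrier) → Carrier → Set (c ⊔ ℓ₃)
  ConvergesTo s l = ∀ ε → 0# < ε →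
    ∃[ N ] (∀ p → N ℕ.≤ p → Within ε (s p) l)

  field
    complete : ∀ s → IsCauchy s → ∃[ l ] ConvergesTo s l


module Matrices {c ℓ₁ ℓ₂} (F : HeytingField c ℓ₁ ℓ₂) where

  open HeytingField F public
    using (Carrier; _≈_; _#_; _+_; _*_; -_; _-_; 0#; 1#; #⇒invertible; heytingCommutativeRing)

  commutativeRing : CommutativeRing c ℓ₁
  commutativeRing = HeytingCommutativeRing.commutativeRing heytingCommutativeRing

  private module R = CommutativeRing commutativeRing

  open RawSemiringDefinitions (Semiring.rawSemiring R.semiring) public using (sum; _^_)

  -- The library's axiom inverts x - 0#; *-reciprocal confirms that this is
  -- an inverse of x.
  reciprocal : ∀ x → x # 0# → Carrier
  reciprocal x x#0 = proj₁ (#⇒invertible x#0)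

  *-reciprocal : ∀ x (x#0 : x # 0#) → x * reciprocal x x#0 ≈ 1#
  *-reciprocal x x#0 = R.trans (R.*-congʳ x≈x-0) (proj₂ (proj₂ (#⇒invertible x#0)))
    where
    x≈x-0 : x ≈ x - 0#
    x≈x-0 = R.sym (R.trans (R.+-congˡ (RingProperties.-0#≈0# R.ring)) (R.+-identityʳ x))

  quotient : ∀ x y → y # 0# → Carrier
  quotient x y y#0 = x * reciprocal y y#0

  Matrix : ℕ → ℕ → Set c
  Matrix m n = Fin m → Fin n → Carrier

  infixl 7 _*ᴹ_
  _*ᴹ_ : ∀ {m n p} → Matrix m n → Matrix n p → Matrix m p
  (A *ᴹ B) i j = sum (λ l → A i l * B l j)

  identity : ∀ m → Matrix m m
  identity m i j = if does (i ≟ j) then 1# else 0#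

  LinearCombination : ∀ {m s} → Vector Carrier s → (Fin s → Vector Carrier m) → Vector Carrier m
  LinearCombination a v i = sum (λ l → a l * v l i)

  InSpan : ∀ {m s} → Vector Carrier m → (Fin s → Vector Carrier m) → Set (c ⊔ ℓ₁)
  InSpan u v = ∃[ a ] (∀ i → u i ≈ LinearCombination a v i)

  LinearlyIndependent : ∀ {m s} → (Fin s → Vector Carrier m) → Set (c ⊔ ℓ₁)
  LinearlyIndependent v =
    ∀ a → (∀ i → LinearCombination a v i ≈ 0#) → ∀ l → a l ≈ 0#

  column : ∀ {m n} → Matrix m n → Fin n → Vector Carrier m
  column A j i = A i j

  -- The column space has dimension r.
  record HasRank {m n} (A : Matrix m n) (r : ℕ) : Set (c ⊔ ℓ₁) where
    field
      basis         : Fin r → Vector Carrier m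
      independent   : LinearlyIndependent basis
      inColumnSpace : ∀ l → InSpan (basis l) (column A)
      spanning      : ∀ j → InSpan (column A j) basis

  -- Laplace expansion along the first column.
  det : ∀ {p} → Matrix p p → Carrier
  det {zero}  B = 1#
  det {suc p} B =
    sum (λ i → (- 1#) ^ toℕ i * (B i zero * det (λ s t → B (punchIn i s) (suc t))))

  minor : ∀ {m n p} → Matrix m n → Vector (Fin m) p → Vector (Fin n) p → Carrier
  minor A rows cols = det (λ s t → A (rows s) (cols t))

  -- The index sequence 1 … k.
  first : ∀ {k m} → .(k ℕ.≤ m) → Vector (Fin m) k
  first k≤m s = inject≤ s k≤m

  infixl 5 _∷ʳ_
  _∷ʳ_ : ∀ {a k} {X : Set a} → Vector X k → X → Vector X (suc k)
  xs ∷ʳ x = insertAt xs (fromℕ _) x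

  leadingMinor : ∀ {m n} → Matrix m n → ∀ k → .(k ℕ.≤ m) → .(k ℕ.≤ n) → Carrier
  leadingMinor A k k≤m k≤n = minor A (first {k} k≤m) (first {k} k≤n)

  -- Gauss–Jordan procedure.  Indices are zero-based: the usual entry
  -- (k+1, k+1) is the entry in row fromℕ< k<m and column fromℕ< k<n.

  record HasPivot {m n} (B : Matrix m n) (k : ℕ) : Set ℓ₂ where
    field
      k<m     : k ℕ.< m
      k<n     : k ℕ.< n

    row : Fin m
    row = fromℕ< k<m

    col : Fin n
    col = fromℕ< k<n

    field
      pivot#0 : B row col # 0#

  -- 𝒢₂ₖ₊₁, where B = A⁽²ᵏ⁾
  scaling : ∀ {m n} (B : Matrix m n) k → HasPivot B k → Matrix m m
  scaling B k piv i j =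
    if does (i ≟ j)
    then (if does (i ≟ row) then reciprocal (B row col) pivot#0 else 1#)
    else 0#
    where open HasPivot piv

  -- 𝒢₂ₖ₊₂, where B = A⁽²ᵏ⁺¹⁾ and (row, col) is the pivot position
  elimination : ∀ {m n} → Matrix m n → Fin m → Fin n → Matrix m m
  elimination B row col i j =
    if does (i ≟ j) then 1# else
    if does (j ≟ row) then - B i col else 0#

  -- Defined A k says that A⁽²ᵏ⁾ is defined; evenStage A k is then A⁽²ᵏ⁾ and
  -- oddStage A k is A⁽²ᵏ⁺¹⁾.
  Defined   : ∀ {m n} → Matrix m n → ℕ → Set ℓ₂
  evenStage : ∀ {m n} (A : Matrix m n) k → Defined A k → Matrix m n
  oddStage  : ∀ {m n} (A : Matrix m n) k (d : Defined A k) →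
              HasPivot (evenStage A k d) k → Matrix m n

  Defined A zero    = ⊤
  Defined A (suc k) = Σ[ d ∈ Defined A k ] HasPivot (evenStage A k d) k

  evenStage A zero    _         = A
  evenStage A (suc k) (d , piv) =
    elimination (oddStage A k d piv) (HasPivot.row piv) (HasPivot.col piv) *ᴹ oddStage A k d piv

  oddStage A k d piv = scaling (evenStage A k d) k piv *ᴹ evenStage A k d

  -- k ranges over 0, …, r - 1, one less than the one-based pivot index.
  record DiagonallyEliminable {m n} (A : Matrix m n) (r : ℕ) : Set ℓ₂ where
    field
      defined : ∀ {k} → k ℕ.< r → Defined A k
      pivot   : ∀ {k} (k<r : k ℕ.< r) → HasPivot (evenStage A k (defined k<r)) k

    k≤rows : ∀ {k} → k ℕ.< r → k ℕ.≤ m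
    k≤rows k<r = <⇒≤ (HasPivot.k<m (pivot k<r))

    k≤cols : ∀ {k} → k ℕ.< r → k ℕ.≤ n
    k≤cols k<r = <⇒≤ (HasPivot.k<n (pivot k<r))

{-# OPTIONS --safe #-}
-- Write B = A⁽²ᵏ⁾.  Undoing the row operations one pivot at a time expresses
-- column j of A through its first k columns:
--   a_ij = Σ_{l ≤ k} b_lj a_il + (b_ij if i > k, and 0 otherwise).
-- Substituting this for column j in a minor containing it and using that
-- minors are linear and alternating in the columns leaves one term (Cramer's
-- rule):  m^{1…k}_{1…î…k,j} = (-1)^{k+i} b_ij m_k  and  m^{1…k,i}_{1…k,j} = b_ij m_k.
-- The latter at the pivot shows that m_{k+1} is m_k times the pivot, so m_k ≠ 0.
module Submission where

open import Defs
open import Data.Fin.Base using (Fin; toℕ; inject≤; inject₁)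
open import Data.Nat.Base as ℕ using (ℕ; suc)
open import Data.Product.Base using (Σ-syntax; _×_)
open import Data.Vec.Functional using (removeAt)
open import Algebra.Apartness.Bundles using (HeytingField)
open import Algebra.Bundles using (CommutativeRing)
import Algebra.Apartness.Properties.HeytingCommutativeRing as HeytingProperties
import Algebra.Properties.Ring as RingProperties
import Algebra.Properties.Semiring.Exp as ExpProperties
import Algebra.Properties.Semiring.Sum as SumProperties
import Algebra.Solver.Ring.NaturalCoefficients.Default as SemiringSolver
open import Data.Bool.Base using (if_then_else_)
open import Data.Fin.Base using (zero; suc; fromℕ; fromℕ<; punchIn)
open import Data.Fin.Properties using (_≟_; punchInᵢ≢i; toℕ-injective; toℕ-inject≤; toℕ-inject₁; toℕ-fromℕ; toℕ-fromℕ<; toℕ<n)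
open import Data.Nat.Base using (zero)
import Data.Nat.Properties as ℕₚ
open import Data.Product.Base using (_,_; proj₂)
open import Data.Sum.Base using (_⊎_; inj₁; inj₂)
open import Data.Unit.Polymorphic.Base using (⊤; tt)
open import Data.Vec.Functional using (Vector; insertAt; replicate; tail) renaming (_∷_ to _◂_)
open import Data.Vec.Functional.Properties using (insertAt-lookup; insertAt-punchIn; insertAt-removeAt)
open import Function.Base using (_∘_)
open import Relation.Binary.PropositionalEquality as ≡ using (_≡_; _≢_; _≗_)
open import Relation.Binary.Definitions using (tri<; tri≈; tri>)
import Relation.Binary.Reasoning.Setoid as SetoidReasoning
open import Relation.Nullary.Decidable using (Dec; does; yes; no; dec-true; dec-false)
open import Relation.Nullary.Negation using (contradiction)

module _ {c ℓ₁ ℓ₂} (F : HeytingField c ℓ₁ ℓ₂) where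

  open Matrices F
  open CommutativeRing commutativeRing
    using ( refl; sym; trans; reflexive; setoid; ring; semiring; commutativeSemiring
          ; +-cong; +-congˡ; +-congʳ; +-assoc; +-identityˡ; +-identityʳ
          ; *-cong; *-congˡ; *-congʳ; *-assoc; *-comm; *-identityˡ; *-identityʳ
          ; zeroˡ; zeroʳ; -‿inverseˡ; -‿inverseʳ; -‿cong; +-comm; distribʳ )
  open RingProperties ring using (-1*x≈-x; -0#≈0#; -‿involutive; -‿distribˡ-*)
  open ExpProperties semiring using (^-homo-*)
  open SumProperties semiring
    using (sum-cong-≋; sum-replicate-zero; sum-remove; sum-init-last; ∑-distrib-+; ∑-comm; *-distribˡ-sum)
  open HeytingProperties heytingCommutativeRing using (1#0; x#0y#0→xy#0; #-congʳ)
  open SemiringSolver commutativeSemiring using (solve; _:=_; _:+_; _:*_; con)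
  open SetoidReasoning setoid

  -- Signs and finite sums

  private
    ε : Carrier
    ε = - 1#

  ε*ε≈1 : ε * ε ≈ 1#
  ε*ε≈1 = trans (-1*x≈-x ε) (-‿involutive 1#)

  x+εx≈0 : ∀ x → x + ε * x ≈ 0#
  x+εx≈0 x = trans (+-congˡ (-1*x≈-x x)) (-‿inverseʳ x)

  -- A sign is its own inverse, so signs can change sides of an equation without division.
  ε^n*ε^n≈1 : ∀ n → ε ^ n * ε ^ n ≈ 1#
  ε^n*ε^n≈1 zero    = *-identityˡ 1#
  ε^n*ε^n≈1 (suc n) = begin
    ε * ε ^ n * (ε * ε ^ n)  ≈⟨ solve 2 (λ e x → e :* x :* (e :* x) := e :* e :* (x :* x)) refl ε (ε ^ n) ⟩
    ε * ε * (ε ^ n * ε ^ n)  ≈⟨ *-cong ε*ε≈1 (ε^n*ε^n≈1 n) ⟩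
    1# * 1#                  ≈⟨ *-identityˡ 1# ⟩
    1#                       ∎

  sum-zero : ∀ {n} (t : Vector Carrier n) → (∀ i → t i ≈ 0#) → sum t ≈ 0#
  sum-zero {n} t t≈0 = trans (sum-cong-≋ t≈0) (sum-replicate-zero n)

  sum-single : ∀ {n} (i : Fin n) (t : Vector Carrier n) →
               (∀ l → l ≢ i → t l ≈ 0#) → sum t ≈ t i
  sum-single {suc n} i t t≈0 = begin
    sum t                     ≈⟨ sum-remove {i = i} t ⟩
    t i + sum (removeAt t i)  ≈⟨ +-congˡ (sum-zero (removeAt t i) λ l → t≈0 _ (punchInᵢ≢i i l)) ⟩
    t i + 0#                  ≈⟨ +-identityʳ (t i) ⟩
    t i                       ∎

  -- Minors as functions of their columns

  det-cong : ∀ {p} {B C : Matrix p p} → (∀ s t → B s t ≈ C s t) → det B ≈ det C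
  det-cong {zero}  B≈C = refl
  det-cong {suc p} {B} {C} B≈C = sum-cong-≋
    {x = λ i → ε ^ toℕ i * (B i zero * det λ s t → B (punchIn i s) (suc t))}
    {y = λ i → ε ^ toℕ i * (C i zero * det λ s t → C (punchIn i s) (suc t))}
    λ i → *-congˡ (*-cong (B≈C i zero) (det-cong λ s t → B≈C (punchIn i s) (suc t)))

  minor-cong : ∀ {m n p} (A : Matrix m n) {ρ ρ′ : Vector (Fin m) p} {κ κ′ : Vector (Fin n) p} →
               ρ ≗ ρ′ → κ ≗ κ′ → minor A ρ κ ≈ minor A ρ′ κ′
  minor-cong A ρ≗ρ′ κ≗κ′ = det-cong λ s t → reflexive (≡.cong₂ A (ρ≗ρ′ s) (κ≗κ′ t))

  minor-congʳ : ∀ {m n p} (A : Matrix m n) (ρ : Vector (Fin m) p) {κ κ′ : Vector (Fin n) p} →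
                κ ≗ κ′ → minor A ρ κ ≈ minor A ρ κ′
  minor-congʳ A ρ = minor-cong A {ρ} {ρ} (λ _ → ≡.refl)

  -- Expansion along the first two columns x and y; M i s stands for the minor
  -- of the other columns on the rows other than i and punchIn i s.
  expansion₂ : ∀ {n} → Vector Carrier (suc n) → Vector Carrier (suc n) →
               (Fin (suc n) → Fin n → Carrier) → Carrier
  expansion₂ x y M = sum λ i → ε ^ toℕ i * (x i * sum λ s → ε ^ toℕ s * (y (punchIn i s) * M i s))

  -- M i s depends only on the set {i, punchIn i s}.
  Unordered : ∀ {n} → (Fin (suc n) → Fin n → Carrier) → Set ℓ₁
  Unordered {zero}  M = ⊤
  Unordered {suc n} M = (∀ s → M zero s ≈ M (suc s) zero) × Unordered (λ i s → M (suc i) (suc s))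

  -- Removing `zero` first or `suc s` first leaves the same rows: `punchIn zero ∘ punchIn s` and
  -- `punchIn (suc s) ∘ punchIn zero` compute alike. If row 0 survives it stays in front, so the
  -- recursion uses `f` with `zero` prepended.
  unordered : ∀ {p} (M : Fin (suc (suc p)) → Fin (suc p) → Carrier)
              (f : Vector (Fin (suc (suc p))) p → Carrier) → (∀ {u v} → u ≗ v → f u ≈ f v) →
              (∀ i s → M i s ≈ f (punchIn i ∘ punchIn s)) → Unordered M
  unordered {zero}  M f f-cong M≈f =
    (λ s → trans (M≈f zero s) (sym (M≈f (suc s) zero))) , tt
  unordered {suc p} M f f-cong M≈f =
    (λ s → trans (M≈f zero s) (sym (M≈f (suc s) zero))) ,
    unordered _ (λ v → f (zero ◂ suc ∘ v))
      (λ u≗v → f-cong λ { zero → ≡.refl ; (suc t) → ≡.cong suc (u≗v t) })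
      (λ i s → trans (M≈f (suc i) (suc s)) (f-cong λ { zero → ≡.refl ; (suc t) → ≡.refl }))

  -- The pairs of rows are of three kinds: `x` in row 0, `y` in row 0, or neither. In the second
  -- kind `Unordered` exchanges the order of deletion and the shifted row of `x` supplies one `ε`;
  -- in the third both rows are shifted and the two factors `ε` cancel.
  expansion₂-step : ∀ {n} (x y : Vector Carrier (suc (suc n))) M → Unordered M →
    let P = λ (u v : Vector Carrier (suc (suc n))) →
              u zero * sum (λ s → ε ^ toℕ s * (v (suc s) * M zero s))
    in expansion₂ x y M ≈ P x y + ε * P y x + expansion₂ (tail x) (tail y) (λ i s → M (suc i) (suc s))
  expansion₂-step {n} x y M (sym₀ , _) = begin
    1# * P x y + sum (λ i → ε * e i * (x′ i * (1# * (y₀ * M (suc i) zero) + sum λ s → ε * e s * z i s)))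
      ≈⟨ +-cong (*-identityˡ (P x y)) (sum-cong-≋ term) ⟩
    P x y + sum (λ i → ε * (y₀ * (e i * (x′ i * M zero i))) + e i * (x′ i * S i))
      ≈⟨ +-congˡ (∑-distrib-+ (λ i → ε * (y₀ * (e i * (x′ i * M zero i)))) (λ i → e i * (x′ i * S i))) ⟩
    P x y + (sum (λ i → ε * (y₀ * (e i * (x′ i * M zero i)))) + E)
      ≈⟨ +-congˡ (+-congʳ (*-distribˡ-sum ε (λ i → y₀ * (e i * (x′ i * M zero i))))) ⟨
    P x y + (ε * sum (λ i → y₀ * (e i * (x′ i * M zero i))) + E)
      ≈⟨ +-congˡ (+-congʳ (*-congˡ (*-distribˡ-sum y₀ (λ i → e i * (x′ i * M zero i))))) ⟨
    P x y + (ε * P y x + E)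
      ≈⟨ +-assoc _ _ _ ⟨
    P x y + ε * P y x + E ∎
    where
    P = λ (u v : Vector Carrier (suc (suc n))) →
          u zero * sum (λ s → ε ^ toℕ s * (v (suc s) * M zero s))
    x′ = tail x
    y₀ = y zero
    E  = expansion₂ (tail x) (tail y) (λ i s → M (suc i) (suc s))
    e : ∀ {q} → Fin q → Carrier
    e i = ε ^ toℕ i
    z : Fin (suc n) → Fin n → Carrier
    z i s = y (suc (punchIn i s)) * M (suc i) (suc s)
    S : Fin (suc n) → Carrier
    S i = sum λ s → e s * z i s
    term : ∀ i → ε * e i * (x′ i * (1# * (y₀ * M (suc i) zero) + sum λ s → ε * e s * z i s))
               ≈ ε * (y₀ * (e i * (x′ i * M zero i))) + e i * (x′ i * S i)
    term i = begin
      ε * e i * (x′ i * (1# * (y₀ * M (suc i) zero) + sum λ s → ε * e s * z i s))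
        ≈⟨ *-congˡ (*-congˡ (+-cong (*-congˡ (*-congˡ (sym (sym₀ i))))
             (trans (sum-cong-≋ λ s → *-assoc ε (e s) (z i s)) (sym (*-distribˡ-sum ε λ s → e s * z i s))))) ⟩
      ε * e i * (x′ i * (1# * (y₀ * M zero i) + ε * S i))
        ≈⟨ solve 6 (λ ε e x y m s → ε :* e :* (x :* (con 1 :* (y :* m) :+ ε :* s))
             := ε :* (y :* (e :* (x :* m))) :+ ε :* ε :* (e :* (x :* s))) refl ε (e i) (x′ i) y₀ (M zero i) (S i) ⟩
      ε * (y₀ * (e i * (x′ i * M zero i))) + ε * ε * (e i * (x′ i * S i))
        ≈⟨ +-congˡ (trans (*-congʳ ε*ε≈1) (*-identityˡ _)) ⟩
      ε * (y₀ * (e i * (x′ i * M zero i))) + e i * (x′ i * S i) ∎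

  -- One row cannot carry two columns: the inner sum is empty.
  expansion₂-empty : ∀ (x y : Vector Carrier 1) M → expansion₂ x y M ≈ 0#
  expansion₂-empty x y M = solve 1 (λ x → con 1 :* (x :* con 0) :+ con 0 := con 0) refl (x zero)

  -- With equal columns the two terms through row 0 cancel, and what remains has one row fewer.
  -- Deriving this from `expansion₂-swap` would require 2 to be invertible.
  expansion₂-alternating : ∀ {n} (x : Vector Carrier (suc n)) M → Unordered M → expansion₂ x x M ≈ 0#
  expansion₂-alternating {zero}  x M u = expansion₂-empty x x M
  expansion₂-alternating {suc n} x M u = begin
    expansion₂ x x M  ≈⟨ expansion₂-step x x M u ⟩
    _                 ≈⟨ +-cong (x+εx≈0 _) (expansion₂-alternating (tail x) _ (proj₂ u)) ⟩
    0# + 0#           ≈⟨ +-identityˡ 0# ⟩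
    0#                ∎

  -- The two terms through row 0 trade places up to the factor `ε`; induction handles the rest.
  expansion₂-swap : ∀ {n} (x y : Vector Carrier (suc n)) M → Unordered M →
                    expansion₂ x y M ≈ ε * expansion₂ y x M
  expansion₂-swap {zero}  x y M u = begin
    expansion₂ x y M      ≈⟨ expansion₂-empty x y M ⟩
    0#                    ≈⟨ zeroʳ ε ⟨
    ε * 0#                ≈⟨ *-congˡ (expansion₂-empty y x M) ⟨
    ε * expansion₂ y x M  ∎
  expansion₂-swap {suc n} x y M u = begin
    expansion₂ x y M               ≈⟨ expansion₂-step x y M u ⟩
    Pxy + ε * Pyx + _              ≈⟨ +-congˡ (expansion₂-swap (tail x) (tail y) _ (proj₂ u)) ⟩
    -- With `ε * ε` in front of `Pxy`, one factor `ε` comes out of every term.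
    Pxy + ε * Pyx + ε * E          ≈⟨ +-congʳ (+-congʳ (trans (*-congʳ ε*ε≈1) (*-identityˡ Pxy))) ⟨
    ε * ε * Pxy + ε * Pyx + ε * E  ≈⟨ solve 4 (λ ε p q r → ε :* ε :* p :+ ε :* q :+ ε :* r
                                        := ε :* (q :+ ε :* p :+ r)) refl ε Pxy Pyx E ⟩
    ε * (Pyx + ε * Pxy + E)        ≈⟨ *-congˡ (expansion₂-step y x M u) ⟨
    ε * expansion₂ y x M           ∎
    where
    Pxy = x zero * sum (λ s → ε ^ toℕ s * (y (suc s) * M zero s))
    Pyx = y zero * sum (λ s → ε ^ toℕ s * (x (suc s) * M zero s))
    E   = expansion₂ (tail y) (tail x) (λ i s → M (suc i) (suc s))

  -- Minors are alternating and linear in the columns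

  minor-unordered : ∀ {m n p} (A : Matrix m n) (ρ : Vector (Fin m) (suc (suc p))) (κ : Vector (Fin n) p) →
                    Unordered (λ i s → minor A (ρ ∘ punchIn i ∘ punchIn s) κ)
  minor-unordered A ρ κ = unordered _ (λ v → minor A (ρ ∘ v) κ)
    (λ u≗v → minor-cong A (λ s → ≡.cong ρ (u≗v s)) (λ _ → ≡.refl)) (λ _ _ → refl)

  -- Two unfoldings of `det` turn the minor into `expansion₂` of its first two columns.
  minor-swap : ∀ {m n p} (A : Matrix m n) (ρ : Vector (Fin m) (suc (suc p))) j₁ j₂ (κ : Vector (Fin n) p) →
               minor A ρ (j₁ ◂ j₂ ◂ κ) ≈ ε * minor A ρ (j₂ ◂ j₁ ◂ κ)
  minor-swap A ρ j₁ j₂ κ =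
    expansion₂-swap (λ s → A (ρ s) j₁) (λ s → A (ρ s) j₂)
    (λ i s → minor A (ρ ∘ punchIn i ∘ punchIn s) κ) (minor-unordered A ρ κ)

  -- A repetition in the first two places is `expansion₂-alternating`. Otherwise a swap brings
  -- another column to the front, and expanding along it leaves smaller minors that still repeat a
  -- column.
  minor-repeated : ∀ {m n p} (A : Matrix m n) (ρ : Vector (Fin m) (suc p)) (κ : Vector (Fin n) p) s →
                   minor A ρ (κ s ◂ κ) ≈ 0#
  minor-repeated A ρ κ zero =
    expansion₂-alternating (λ s → A (ρ s) (κ zero))
    (λ i s → minor A (ρ ∘ punchIn i ∘ punchIn s) (tail κ)) (minor-unordered A ρ (tail κ))
  minor-repeated A ρ κ (suc s) = begin
    minor A ρ (κ (suc s) ◂ κ)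
      ≈⟨ minor-swap A ρ (κ (suc s)) (κ zero) (tail κ) ⟩
    ε * minor A ρ (κ zero ◂ κ (suc s) ◂ tail κ)
      ≈⟨ *-congˡ (sum-zero (λ i → ε ^ toℕ i * (A (ρ i) (κ zero) * minor A (ρ ∘ punchIn i) (tail κ s ◂ tail κ))) λ i → trans (*-congˡ (trans
           (*-congˡ (minor-repeated A (ρ ∘ punchIn i) (tail κ) s)) (zeroʳ _))) (zeroʳ _)) ⟩
    ε * 0#
      ≈⟨ zeroʳ ε ⟩
    0# ∎

  -- The column passes `toℕ i` others, each exchange costing `ε`. By induction inside the expansion
  -- along `κ zero` it reaches second place, and one swap brings it to the front.
  minor-insertAt : ∀ {m n p} (A : Matrix m n) (ρ : Vector (Fin m) (suc p)) (κ : Vector (Fin n) p) i j →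
                   minor A ρ (insertAt κ i j) ≈ ε ^ toℕ i * minor A ρ (j ◂ κ)
  minor-insertAt A ρ κ zero j = trans
    (minor-congʳ A ρ {insertAt κ zero j} {j ◂ κ} λ { zero → ≡.refl ; (suc t) → ≡.refl })
    (sym (*-identityˡ _))
  minor-insertAt {p = suc p} A ρ κ (suc i) j = begin
    sum (λ s → e s * (A (ρ s) (κ zero) * minor A (ρ ∘ punchIn s) (insertAt (tail κ) i j)))
      ≈⟨ sum-cong-≋ (λ s → trans (*-congˡ (*-congˡ (minor-insertAt A (ρ ∘ punchIn s) (tail κ) i j)))
           (solve 4 (λ e a f m → e :* (a :* (f :* m)) := f :* (e :* (a :* m))) refl (e s) (A (ρ s) (κ zero)) (e i) _)) ⟩
    sum (λ s → e i * (e s * (A (ρ s) (κ zero) * minor A (ρ ∘ punchIn s) (j ◂ tail κ))))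
      ≈⟨ *-distribˡ-sum (e i) (λ s → e s * (A (ρ s) (κ zero) * minor A (ρ ∘ punchIn s) (j ◂ tail κ))) ⟨
    e i * minor A ρ (κ zero ◂ j ◂ tail κ)
      ≈⟨ *-congˡ (minor-swap A ρ (κ zero) j (tail κ)) ⟩
    e i * (ε * minor A ρ (j ◂ κ))
      ≈⟨ solve 3 (λ e ε m → e :* (ε :* m) := ε :* e :* m) refl (e i) ε (minor A ρ (j ◂ κ)) ⟩
    ε * e i * minor A ρ (j ◂ κ) ∎
    where
    e : ∀ {q} → Fin q → Carrier
    e s = ε ^ toℕ s

  -- The remainder `d` is an arbitrary vector rather than a column of `A`, so its share stays a
  -- Laplace expansion along the first column. In the applications `d` is zero or supported in the
  -- last row.
  minor-linear : ∀ {m n p q} (A : Matrix m n) (ρ : Vector (Fin m) (suc p)) (κ : Vector (Fin n) p)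
    (j : Fin n) (λs : Vector (Fin n) q) (b : Vector Carrier q) (d : Vector Carrier (suc p)) →
    (∀ s → A (ρ s) j ≈ sum (λ l → b l * A (ρ s) (λs l)) + d s) →
    minor A ρ (j ◂ κ) ≈ sum (λ l → b l * minor A ρ (λs l ◂ κ))
                        + sum (λ s → ε ^ toℕ s * (d s * minor A (ρ ∘ punchIn s) κ))
  minor-linear {p = p} {q} A ρ κ j λs b d col = begin
    sum (λ s → e s * (A (ρ s) j * M s))
      ≈⟨ sum-cong-≋ term ⟩
    sum (λ s → sum (λ l → b l * (e s * (A (ρ s) (λs l) * M s))) + e s * (d s * M s))
      ≈⟨ ∑-distrib-+ (λ s → sum (λ l → b l * (e s * (A (ρ s) (λs l) * M s)))) (λ s → e s * (d s * M s)) ⟩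
    sum (λ s → sum (λ l → b l * (e s * (A (ρ s) (λs l) * M s)))) + sum (λ s → e s * (d s * M s))
      ≈⟨ +-congʳ (trans (∑-comm (λ s l → b l * (e s * (A (ρ s) (λs l) * M s))))
           (sum-cong-≋ λ l → sym (*-distribˡ-sum (b l) (λ s → e s * (A (ρ s) (λs l) * M s))))) ⟩
    sum (λ l → b l * minor A ρ (λs l ◂ κ)) + sum (λ s → e s * (d s * M s)) ∎
    where
    e : Fin (suc p) → Carrier
    e s = ε ^ toℕ s
    M : Fin (suc p) → Carrier
    M s = minor A (ρ ∘ punchIn s) κ
    term : ∀ s → e s * (A (ρ s) j * M s)
               ≈ sum (λ l → b l * (e s * (A (ρ s) (λs l) * M s))) + e s * (d s * M s)
    term s = begin
      e s * (A (ρ s) j * M s)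
        ≈⟨ *-congˡ (*-congʳ (col s)) ⟩
      e s * ((sum (λ l → b l * A (ρ s) (λs l)) + d s) * M s)
        ≈⟨ solve 4 (λ e x d m → e :* ((x :+ d) :* m) := e :* m :* x :+ e :* (d :* m)) refl (e s) _ (d s) (M s) ⟩
      e s * M s * sum (λ l → b l * A (ρ s) (λs l)) + e s * (d s * M s)
        ≈⟨ +-congʳ (trans (*-distribˡ-sum (e s * M s) (λ l → b l * A (ρ s) (λs l))) (sum-cong-≋ λ l →
             solve 4 (λ e m b a → e :* m :* (b :* a) := b :* (e :* (a :* m))) refl (e s) (M s) (b l) (A (ρ s) (λs l)))) ⟩
      sum (λ l → b l * (e s * (A (ρ s) (λs l) * M s))) + e s * (d s * M s) ∎

  -- Cramer's rule and bordered minors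

  removeAt-∷ʳ : ∀ {a} {X : Set a} {k} (xs : Vector X (suc k)) x i →
                removeAt (xs ∷ʳ x) (inject₁ i) ≗ removeAt xs i ∷ʳ x
  removeAt-∷ʳ             xs x zero    t       = ≡.refl
  removeAt-∷ʳ {k = suc k} xs x (suc i) zero    = ≡.refl
  removeAt-∷ʳ {k = suc k} xs x (suc i) (suc t) = removeAt-∷ʳ (tail xs) x i t

  ∷ʳ-pairs : ∀ {a b ℓ} {X : Set a} {Y : Set b} (Q : X → Y → Set ℓ) {k}
             (xs : Vector X k) (ys : Vector Y k) {x y} →
             (∀ s → Q (xs s) (ys s)) → Q x y → ∀ s → Q ((xs ∷ʳ x) s) ((ys ∷ʳ y) s)
  ∷ʳ-pairs Q {zero}  xs ys qs q zero    = q
  ∷ʳ-pairs Q {suc k} xs ys qs q zero    = qs zero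
  ∷ʳ-pairs Q {suc k} xs ys qs q (suc s) = ∷ʳ-pairs Q (tail xs) (tail ys) (qs ∘ suc) q s

  minor-∷ʳ : ∀ {m n p} (A : Matrix m n) (ρ : Vector (Fin m) (suc p)) (κ : Vector (Fin n) p) j →
             minor A ρ (κ ∷ʳ j) ≈ ε ^ p * minor A ρ (j ◂ κ)
  minor-∷ʳ {p = p} A ρ κ j = trans (minor-insertAt A ρ κ (fromℕ p) j)
    (*-congʳ (reflexive (≡.cong (ε ^_) (toℕ-fromℕ p))))

  -- Column `j`, moved to the front at the cost of `ε ^ k`, is replaced by its combination of the
  -- columns `κ`. All of these except `κ i` already occur in `removeAt κ i`, so only the term of
  -- `b i` survives; returning `κ i` to its place costs `ε ^ toℕ i`.
  cramer : ∀ {m n k} (A : Matrix m n) (ρ : Vector (Fin m) (suc k)) (κ : Vector (Fin n) (suc k))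
    (j : Fin n) (b : Vector Carrier (suc k)) →
    (∀ s → A (ρ s) j ≈ sum (λ l → b l * A (ρ s) (κ l))) → ∀ i →
    minor A ρ (removeAt (κ ∷ʳ j) (inject₁ i)) ≈ ε ^ (k ℕ.+ toℕ i) * (b i * minor A ρ κ)
  cramer {k = k} A ρ κ j b col i = begin
    minor A ρ (removeAt (κ ∷ʳ j) (inject₁ i))
      ≈⟨ minor-congʳ A ρ (removeAt-∷ʳ κ j i) ⟩
    minor A ρ (κ̂ ∷ʳ j)
      ≈⟨ minor-∷ʳ A ρ κ̂ j ⟩
    ε ^ k * minor A ρ (j ◂ κ̂)
      ≈⟨ *-congˡ (minor-linear A ρ κ̂ j κ b (λ _ → 0#) (λ s → trans (col s) (sym (+-identityʳ _)))) ⟩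
    ε ^ k * (sum (λ l → b l * minor A ρ (κ l ◂ κ̂)) + sum (λ s → ε ^ toℕ s * (0# * minor A (ρ ∘ punchIn s) κ̂)))
      ≈⟨ *-congˡ (+-cong
           (trans (sum-remove {i = i} (λ l → b l * minor A ρ (κ l ◂ κ̂)))
             (+-congˡ (sum-zero (λ l → b (punchIn i l) * minor A ρ (κ̂ l ◂ κ̂)) λ l → trans (*-congˡ (minor-repeated A ρ κ̂ l)) (zeroʳ _))))
           (sum-zero (λ s → ε ^ toℕ s * (0# * minor A (ρ ∘ punchIn s) κ̂)) λ s → trans (*-congˡ (zeroˡ _)) (zeroʳ _))) ⟩
    ε ^ k * (b i * minor A ρ (κ i ◂ κ̂) + 0# + 0#)
      ≈⟨ *-congˡ (trans (+-identityʳ _) (+-identityʳ _)) ⟩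
    ε ^ k * (b i * minor A ρ (κ i ◂ κ̂))
      ≈⟨ *-congˡ (*-congˡ reinsert) ⟩
    ε ^ k * (b i * (ε ^ toℕ i * minor A ρ κ))
      ≈⟨ solve 4 (λ e b f m → e :* (b :* (f :* m)) := e :* f :* (b :* m)) refl (ε ^ k) (b i) (ε ^ toℕ i) (minor A ρ κ) ⟩
    ε ^ k * ε ^ toℕ i * (b i * minor A ρ κ)
      ≈⟨ *-congʳ (^-homo-* ε k (toℕ i)) ⟨
    ε ^ (k ℕ.+ toℕ i) * (b i * minor A ρ κ) ∎
    where
    κ̂ = removeAt κ i
    -- This is `minor-insertAt` solved for its right-hand minor, the sign being its own inverse.
    reinsert : minor A ρ (κ i ◂ κ̂) ≈ ε ^ toℕ i * minor A ρ κ
    reinsert = begin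
      minor A ρ (κ i ◂ κ̂)
        ≈⟨ trans (*-congʳ (ε^n*ε^n≈1 (toℕ i))) (*-identityˡ _) ⟨
      ε ^ toℕ i * ε ^ toℕ i * minor A ρ (κ i ◂ κ̂)
        ≈⟨ *-assoc _ _ _ ⟩
      ε ^ toℕ i * (ε ^ toℕ i * minor A ρ (κ i ◂ κ̂))
        ≈⟨ *-congˡ (minor-insertAt A ρ κ̂ i (κ i)) ⟨
      ε ^ toℕ i * minor A ρ (insertAt κ̂ i (κ i))
        ≈⟨ *-congˡ (minor-congʳ A ρ (insertAt-removeAt κ i)) ⟩
      ε ^ toℕ i * minor A ρ κ ∎

  -- Each column of the combination repeats one in `κ`, so only the remainder counts, and it lives
  -- in the last row. The sign of that row and the sign of moving column `j` to the front are both
  -- `ε ^ k` and cancel.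
  bordered-minor : ∀ {m n k} (A : Matrix m n) (ρ : Vector (Fin m) k) (κ : Vector (Fin n) k)
    (i : Fin m) (j : Fin n) (b : Vector Carrier k) (d : Carrier) →
    (∀ s → A (ρ s) j ≈ sum (λ l → b l * A (ρ s) (κ l))) →
    A i j ≈ sum (λ l → b l * A i (κ l)) + d →
    minor A (ρ ∷ʳ i) (κ ∷ʳ j) ≈ d * minor A ρ κ
  bordered-minor {k = k} A ρ κ i j b d top bottom = begin
    minor A ρᵢ (κ ∷ʳ j)
      ≈⟨ minor-∷ʳ A ρᵢ κ j ⟩
    ε ^ k * minor A ρᵢ (j ◂ κ)
      ≈⟨ *-congˡ (minor-linear A ρᵢ κ j κ b ds col) ⟩
    ε ^ k * (sum (λ l → b l * minor A ρᵢ (κ l ◂ κ)) + sum t)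
      ≈⟨ *-congˡ (+-cong
           (sum-zero (λ l → b l * minor A ρᵢ (κ l ◂ κ)) λ l → trans (*-congˡ (minor-repeated A ρᵢ κ l)) (zeroʳ _))
           (trans (sum-remove {i = fromℕ k} t) (+-cong last-term (sum-zero (removeAt t (fromℕ k)) other-terms)))) ⟩
    ε ^ k * (0# + (ε ^ k * (d * minor A ρ κ) + 0#))
      ≈⟨ solve 2 (λ e x → e :* (con 0 :+ (e :* x :+ con 0)) := e :* e :* x) refl (ε ^ k) (d * minor A ρ κ) ⟩
    ε ^ k * ε ^ k * (d * minor A ρ κ)
      ≈⟨ trans (*-congʳ (ε^n*ε^n≈1 k)) (*-identityˡ _) ⟩
    d * minor A ρ κ ∎
    where
    ρᵢ = ρ ∷ʳ i
    -- The remainder of column `j`: zero on the rows `ρ` by `top`, and `d` in the added row by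
    -- `bottom`.
    ds : Vector Carrier (suc k)
    ds = replicate k 0# ∷ʳ d
    t : Vector Carrier (suc k)
    t s = ε ^ toℕ s * (ds s * minor A (ρᵢ ∘ punchIn s) κ)
    col : ∀ s → A (ρᵢ s) j ≈ sum (λ l → b l * A (ρᵢ s) (κ l)) + ds s
    col = ∷ʳ-pairs (λ i′ d′ → A i′ j ≈ sum (λ l → b l * A i′ (κ l)) + d′) ρ (replicate k 0#)
            (λ s → trans (top s) (sym (+-identityʳ _))) bottom
    -- Deleting the last row of `ρᵢ` gives back `ρ`.
    last-term : t (fromℕ k) ≈ ε ^ k * (d * minor A ρ κ)
    last-term = *-cong (reflexive (≡.cong (ε ^_) (toℕ-fromℕ k)))
      (*-cong (reflexive (insertAt-lookup (replicate k 0#) (fromℕ k) d))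
              (minor-cong A (insertAt-punchIn ρ (fromℕ k) i) (λ _ → ≡.refl)))
    other-terms : ∀ s → t (punchIn (fromℕ k) s) ≈ 0#
    other-terms s = trans (*-congˡ (trans
      (*-congʳ (reflexive (insertAt-punchIn (replicate k 0#) (fromℕ k) d s))) (zeroˡ _))) (zeroʳ _)

  -- Gauss–Jordan steps

  if-≡ : ∀ {m} (i : Fin m) {x y : Carrier} → (if does (i ≟ i) then x else y) ≈ x
  if-≡ i with i ≟ i
  ... | yes _  = refl
  ... | no i≢i = contradiction ≡.refl i≢i

  if-≢ : ∀ {m} {i l : Fin m} {x y : Carrier} → i ≢ l → (if does (i ≟ l) then x else y) ≈ y
  if-≢ {i = i} {l} i≢l with i ≟ l
  ... | yes i≡l = contradiction i≡l i≢l
  ... | no _    = refl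

  module _ {m n} (B : Matrix m n) (k : ℕ) (piv : HasPivot B k) where

    open HasPivot piv

    private
      p⁻¹ : Carrier
      p⁻¹ = reciprocal (B row col) pivot#0
      O : Matrix m n
      O = scaling B k piv *ᴹ B

    -- One full round: for `B` = A⁽²ᵏ⁾ it unfolds to A⁽²ᵏ⁺²⁾, so facts about `evenStage` follow by
    -- induction from facts about a single round.
    step : Matrix m n
    step = elimination O row col *ᴹ O

    scaling-row : ∀ j → O row j ≈ p⁻¹ * B row j
    scaling-row j = trans
      (sum-single row (λ l → scaling B k piv row l * B l j)
        λ l l≢row → trans (*-congʳ (if-≢ (l≢row ∘ ≡.sym))) (zeroˡ _))
      (*-congʳ (trans (if-≡ row) (if-≡ row)))

    scaling-other : ∀ {i} j → i ≢ row → O i j ≈ B i j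
    scaling-other {i} j i≢row = trans
      (sum-single i (λ l → scaling B k piv i l * B l j)
        λ l l≢i → trans (*-congʳ (if-≢ (l≢i ∘ ≡.sym))) (zeroˡ _))
      (trans (*-congʳ (trans (if-≡ i) (if-≢ i≢row))) (*-identityˡ _))

    step-row : ∀ j → step row j ≈ p⁻¹ * B row j
    step-row j = begin
      step row j       ≈⟨ sum-single row (λ l → elimination O row col row l * O l j)
                            (λ l l≢row → trans (*-congʳ (trans (if-≢ (l≢row ∘ ≡.sym)) (if-≢ l≢row))) (zeroˡ _)) ⟩
      _                ≈⟨ trans (*-congʳ (if-≡ row)) (*-identityˡ _) ⟩
      O row j          ≈⟨ scaling-row j ⟩
      p⁻¹ * B row j    ∎

    -- Off the pivot row the diagonal entry and the eliminating entry sit in different places, so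
    -- the nested choice becomes a sum. The product with `O` then splits into two sums with a single
    -- contributing term each.
    elimination-other : ∀ {i} l → i ≢ row → elimination O row col i l
                        ≈ identity m i l + (if does (l ≟ row) then - O i col else 0#)
    elimination-other {i} l i≢row = go (i ≟ l)
      where
      go : Dec (i ≡ l) → elimination O row col i l
                         ≈ identity m i l + (if does (l ≟ row) then - O i col else 0#)
      go (yes ≡.refl) = trans (if-≡ i) (sym (trans (+-cong (if-≡ i) (if-≢ i≢row)) (+-identityʳ 1#)))
      go (no i≢l)     = trans (if-≢ i≢l) (sym (trans (+-congʳ (if-≢ i≢l)) (+-identityˡ _)))

    step-other : ∀ {i} j → i ≢ row → step i j ≈ B i j + - (B i col * step row j)
    step-other {i} j i≢row = begin
      step i j
        ≈⟨ sum-cong-≋ (λ l → trans (*-congʳ (elimination-other l i≢row))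
             (distribʳ (O l j) (identity m i l) (w l))) ⟩
      sum (λ l → identity m i l * O l j + w l * O l j)
        ≈⟨ ∑-distrib-+ (λ l → identity m i l * O l j) (λ l → w l * O l j) ⟩
      sum (λ l → identity m i l * O l j) + sum (λ l → w l * O l j)
        ≈⟨ +-cong
             (sum-single i (λ l → identity m i l * O l j) λ l l≢i → trans (*-congʳ (if-≢ (l≢i ∘ ≡.sym))) (zeroˡ _))
             (sum-single row (λ l → w l * O l j) λ l l≢row → trans (*-congʳ (if-≢ l≢row)) (zeroˡ _)) ⟩
      identity m i i * O i j + w row * O row j
        ≈⟨ +-cong (trans (*-congʳ (if-≡ i)) (*-identityˡ _)) (*-congʳ (if-≡ row)) ⟩
      O i j + - O i col * O row j
        -- Scaling changes only the pivot row and elimination keeps that row, so `O` can be traded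
        -- for `B` and the finished pivot row.
        ≈⟨ +-cong (scaling-other j i≢row)
             (*-cong (-‿cong (scaling-other col i≢row)) (trans (scaling-row j) (sym (step-row j)))) ⟩
      B i j + - B i col * step row j
        ≈⟨ +-congˡ (-‿distribˡ-* (B i col) (step row j)) ⟨
      B i j + - (B i col * step row j) ∎
      where
      w : Fin m → Carrier
      w l = if does (l ≟ row) then - O i col else 0#

    -- Together with `unstep-other` this inverts a round: old entries come from new ones and the old
    -- pivot column, which is the form that `column-relation` can absorb.
    unstep-row : ∀ j → B row j ≈ step row j * B row col
    unstep-row j = begin
      B row j                            ≈⟨ *-identityˡ _ ⟨
      1# * B row j                       ≈⟨ *-congʳ (*-reciprocal (B row col) pivot#0) ⟨
      B row col * p⁻¹ * B row j          ≈⟨ solve 3 (λ p q b → p :* q :* b := q :* b :* p) refl (B row col) p⁻¹ (B row j) ⟩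
      p⁻¹ * B row j * B row col          ≈⟨ *-congʳ (step-row j) ⟨
      step row j * B row col             ∎

    unstep-other : ∀ {i} j → i ≢ row → B i j ≈ step i j + step row j * B i col
    unstep-other {i} j i≢row = begin
      B i j                                             ≈⟨ +-identityʳ _ ⟨
      B i j + 0#                                        ≈⟨ +-congˡ (-‿inverseˡ _) ⟨
      B i j + (- (B i col * step row j) + B i col * step row j)  ≈⟨ +-assoc _ _ _ ⟨
      B i j + - (B i col * step row j) + B i col * step row j    ≈⟨ +-cong (sym (step-other j i≢row)) (*-comm _ _) ⟩
      step i j + step row j * B i col                   ∎

  -- Processed columns are identity columns

  toℕ≢⇒≢fromℕ< : ∀ {m k} {i : Fin m} .(k<m : k ℕ.< m) → toℕ i ≢ k → i ≢ fromℕ< k<m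
  toℕ≢⇒≢fromℕ< k<m i≢k ≡.refl = i≢k (toℕ-fromℕ< k<m)

  toℕ≡⇒≡fromℕ< : ∀ {m k} {i : Fin m} .(k<m : k ℕ.< m) → toℕ i ≡ k → i ≡ fromℕ< k<m
  toℕ≡⇒≡fromℕ< k<m i≡k = toℕ-injective (≡.trans i≡k (≡.sym (toℕ-fromℕ< k<m)))

  -- An earlier column has 0 in the new pivot row, so the round leaves it alone; the pivot column is
  -- made a unit column by the round itself. `j` and `j′` are one number, read as a column index and
  -- as a row index.
  identity-columns : ∀ {m n} (A : Matrix m n) k d i (j : Fin n) (j′ : Fin m) →
                     toℕ j ≡ toℕ j′ → toℕ j ℕ.< k → evenStage A k d i j ≈ identity m i j′
  identity-columns A zero    d         i j j′ j≡j′ ()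
  identity-columns {m} A (suc k) (d , piv) i j j′ j≡j′ j≤k =
    go (ℕₚ.m<1+n⇒m<n∨m≡n j≤k) (i ≟ row)
    where
    open HasPivot piv
    B = evenStage A k d
    B′ = step B k piv

    row≢j′ : toℕ j ℕ.< k → row ≢ j′
    row≢j′ j<k = toℕ≢⇒≢fromℕ< k<m (λ j′≡k → ℕₚ.<⇒≢ j<k (≡.trans j≡j′ j′≡k)) ∘ ≡.sym

    row-zero : toℕ j ℕ.< k → B′ row j ≈ identity m row j′
    row-zero j<k = begin
      B′ row j                   ≈⟨ step-row B k piv j ⟩
      _ * B row j                ≈⟨ *-congˡ (identity-columns A k d row j j′ j≡j′ j<k) ⟩
      _ * identity m row j′      ≈⟨ *-congˡ (if-≢ (row≢j′ j<k)) ⟩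
      _ * 0#                     ≈⟨ zeroʳ _ ⟩
      0#                         ≈⟨ if-≢ (row≢j′ j<k) ⟨
      identity m row j′          ∎

    row-one : B′ row col ≈ 1#
    row-one = trans (step-row B k piv col) (trans (*-comm _ _) (*-reciprocal _ pivot#0))

    go : toℕ j ℕ.< k ⊎ toℕ j ≡ k → Dec (i ≡ row) → B′ i j ≈ identity m i j′
    go (inj₁ j<k) (yes ≡.refl) = row-zero j<k
    go (inj₁ j<k) (no i≢row)   = begin
      B′ i j                            ≈⟨ step-other B k piv j i≢row ⟩
      B i j + - (B i col * B′ row j)    ≈⟨ +-cong (identity-columns A k d i j j′ j≡j′ j<k)
                                             (-‿cong (trans (*-congˡ (trans (row-zero j<k) (if-≢ (row≢j′ j<k)))) (zeroʳ _))) ⟩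
      identity m i j′ + - 0#            ≈⟨ trans (+-congˡ -0#≈0#) (+-identityʳ _) ⟩
      identity m i j′                   ∎
    -- Here `j` and `j′` give the pivot position, so they are replaced by `col` and `row`.
    go (inj₂ j≡k) i≟row
      rewrite toℕ≡⇒≡fromℕ< k<n j≡k | toℕ≡⇒≡fromℕ< {i = j′} k<m (≡.trans (≡.sym j≡j′) j≡k) = last i≟row
      where
      last : Dec (i ≡ row) → B′ i col ≈ identity m i row
      last (yes ≡.refl) = trans row-one (sym (if-≡ row))
      last (no i≢row)   = begin
        B′ i col                            ≈⟨ step-other B k piv col i≢row ⟩
        B i col + - (B i col * B′ row col)  ≈⟨ +-congˡ (-‿cong (trans (*-congˡ row-one) (*-identityʳ _))) ⟩
        B i col + - B i col                 ≈⟨ -‿inverseʳ _ ⟩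
        0#                                  ≈⟨ if-≢ i≢row ⟨
        identity m i row                    ∎

  -- Columns of `A` as combinations of its first columns

  residual : ∀ {m n} → ℕ → Matrix m n → Matrix m n
  residual k B i j = if does (k ℕₚ.≤? toℕ i) then B i j else 0#

  residual-≤ : ∀ {m n} {k} (B : Matrix m n) i j → k ℕ.≤ toℕ i → residual k B i j ≈ B i j
  residual-≤ {k = k} B i j k≤i rewrite dec-true (k ℕₚ.≤? toℕ i) k≤i = refl

  residual-> : ∀ {m n} {k} (B : Matrix m n) i j → toℕ i ℕ.< k → residual k B i j ≈ 0#
  residual-> {k = k} B i j i<k rewrite dec-false (k ℕₚ.≤? toℕ i) (ℕₚ.<⇒≱ i<k) = refl

  -- This tracks the remainder of the column relation through one round. Above the pivot row all
  -- remainders vanish; below it the equation is `unstep-other`.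
  residual-step : ∀ {m n} (B : Matrix m n) k (piv : HasPivot B k) → let open HasPivot piv in ∀ i j →
    residual k B i j ≈ step B k piv row j * residual k B i col + residual (suc k) (step B k piv) i j
  residual-step B k piv i j with ℕₚ.<-cmp (toℕ i) k
  ... | tri< i<k _ _ = begin
    residual k B i j    ≈⟨ residual-> B i j i<k ⟩
    0#                  ≈⟨ trans (+-identityʳ _) (zeroʳ _) ⟨
    B′ row j * 0# + 0#  ≈⟨ +-cong (*-congˡ (residual-> B i col i<k)) (residual-> B′ i j (ℕₚ.m<n⇒m<1+n i<k)) ⟨
    _                   ∎
    where
    open HasPivot piv
    B′ = step B k piv
  -- The pivot row counts in `residual k` but no longer in `residual (suc k)`, so the product with
  -- the pivot must give the whole entry, as `unstep-row` says.
  ... | tri≈ _ i≡k _ rewrite toℕ≡⇒≡fromℕ< (HasPivot.k<m piv) i≡k = begin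
    residual k B row j             ≈⟨ residual-≤ B row j k≤row ⟩
    B row j                        ≈⟨ unstep-row B k piv j ⟩
    B′ row j * B row col           ≈⟨ +-identityʳ _ ⟨
    B′ row j * B row col + 0#      ≈⟨ +-cong (*-congˡ (residual-≤ B row col k≤row))
                                        (residual-> B′ row j (ℕₚ.≤-reflexive (≡.cong suc (toℕ-fromℕ< k<m)))) ⟨
    _                              ∎
    where
    open HasPivot piv
    B′ = step B k piv
    k≤row = ℕₚ.≤-reflexive (≡.sym (toℕ-fromℕ< k<m))
  ... | tri> _ i≢k k<i = begin
    residual k B i j             ≈⟨ residual-≤ B i j (ℕₚ.<⇒≤ k<i) ⟩
    B i j                        ≈⟨ unstep-other B k piv j (toℕ≢⇒≢fromℕ< k<m i≢k) ⟩
    B′ i j + B′ row j * B i col  ≈⟨ +-comm _ _ ⟩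
    B′ row j * B i col + B′ i j  ≈⟨ +-cong (*-congˡ (residual-≤ B i col (ℕₚ.<⇒≤ k<i))) (residual-≤ B′ i j k<i) ⟨
    _                            ∎
    where
    open HasPivot piv
    B′ = step B k piv

  inject≤-inject₁ : ∀ {k m} (l : Fin k) .(k<m : k ℕ.< m) .(k≤m : k ℕ.≤ m) → inject≤ (inject₁ l) k<m ≡ inject≤ l k≤m
  inject≤-inject₁ l k<m k≤m = toℕ-injective (≡.trans (toℕ-inject≤ _ k<m)
    (≡.trans (toℕ-inject₁ l) (≡.sym (toℕ-inject≤ l k≤m))))

  inject≤-fromℕ : ∀ {k m} .(k<m : k ℕ.< m) → inject≤ (fromℕ k) k<m ≡ fromℕ< k<m
  inject≤-fromℕ {k} k<m = toℕ≡⇒≡fromℕ< k<m (≡.trans (toℕ-inject≤ _ k<m) (toℕ-fromℕ k))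

  -- Undoing one more round turns each old coefficient into the new one plus `b` times an entry of
  -- the pivot column. The terms with `b` then assemble into `b * A i col`, the summand that the new
  -- pivot adds.
  column-relation : ∀ {m n} (A : Matrix m n) k (d : Defined A k) .(k≤m : k ℕ.≤ m) .(k≤n : k ℕ.≤ n) i j →
    A i j ≈ sum (λ l → evenStage A k d (first k≤m l) j * A i (first k≤n l)) + residual k (evenStage A k d) i j
  column-relation A zero    d         k≤m k≤n i j = sym (+-identityˡ _)
  column-relation {m} {n} A (suc k) (d , piv) k<m k<n i j = begin
    A i j
      ≈⟨ column-relation A k d k≤m k≤n i j ⟩
    sum (λ l → B (first k≤m l) j * a l) + residual k B i j
      ≈⟨ +-cong (sum-cong-≋ term) (residual-step B k piv i j) ⟩
    sum (λ l → B′ (first k≤m l) j * a l + b * (B (first k≤m l) col * a l))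
      + (b * residual k B i col + residual (suc k) B′ i j)
      ≈⟨ +-congʳ (trans (∑-distrib-+ (λ l → B′ (first k≤m l) j * a l) (λ l → b * (B (first k≤m l) col * a l)))
           (+-congˡ (sym (*-distribˡ-sum b (λ l → B (first k≤m l) col * a l))))) ⟩
    sum (λ l → B′ (first k≤m l) j * a l) + b * sum (λ l → B (first k≤m l) col * a l)
      + (b * residual k B i col + residual (suc k) B′ i j)
      ≈⟨ solve 5 (λ s b t r q → s :+ b :* t :+ (b :* r :+ q) := s :+ b :* (t :+ r) :+ q) refl _ b _ _ _ ⟩
    sum (λ l → B′ (first k≤m l) j * a l)
      + b * (sum (λ l → B (first k≤m l) col * a l) + residual k B i col) + residual (suc k) B′ i j
      -- The bracket is the relation at stage `k` again, now read for the pivot column.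
      ≈⟨ +-congʳ (+-congˡ (*-congˡ (column-relation A k d k≤m k≤n i col))) ⟨
    sum (λ l → B′ (first k≤m l) j * a l) + b * A i col + residual (suc k) B′ i j
      ≈⟨ +-congʳ (+-cong
           (sum-cong-≋ λ l → reflexive (≡.cong₂ (λ u v → B′ u j * A i v)
             (inject≤-inject₁ l k<m k≤m) (inject≤-inject₁ l k<n k≤n)))
           (reflexive (≡.cong₂ (λ u v → B′ u j * A i v) (inject≤-fromℕ k<m) (inject≤-fromℕ k<n)))) ⟨
    sum (λ l → t (inject₁ l)) + t (fromℕ k) + residual (suc k) B′ i j
      ≈⟨ +-congʳ (sum-init-last t) ⟨
    sum t + residual (suc k) B′ i j ∎
    where
    open HasPivot piv using (row; col)
    B  = evenStage A k d
    B′ = step B k piv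
    b  = B′ row j
    k≤m : k ℕ.≤ m
    k≤m = ℕₚ.<⇒≤ (HasPivot.k<m piv)
    k≤n : k ℕ.≤ n
    k≤n = ℕₚ.<⇒≤ (HasPivot.k<n piv)
    a : Vector Carrier k
    a l = A i (first k≤n l)
    t : Vector Carrier (suc k)
    t l = B′ (first k<m l) j * A i (first k<n l)
    term : ∀ l → B (first k≤m l) j * a l ≈ B′ (first k≤m l) j * a l + b * (B (first k≤m l) col * a l)
    -- The first `k` rows lie above the pivot row, so `unstep-other` applies to them.
    term l = trans
      (*-congʳ (unstep-other B k piv j (toℕ≢⇒≢fromℕ< (HasPivot.k<m piv)
        λ l≡k → ℕₚ.<⇒≢ (toℕ<n l) (≡.trans (≡.sym (toℕ-inject≤ l k≤m)) l≡k))))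
      (solve 4 (λ x b y a → (x :+ b :* y) :* a := x :* a :+ b :* (y :* a)) refl _ b _ (a l))

  -- Minors of A in terms of the stages

  module _ {m n} (A : Matrix m n) (k : ℕ) (d : Defined A k) .(k≤m : k ℕ.≤ m) .(k≤n : k ℕ.≤ n) where

    private
      B : Matrix m n
      B = evenStage A k d

    -- The remainder vanishes on the first `k` rows; this is the exact combination that `cramer` and
    -- `bordered-minor` ask for.
    top-relation : ∀ j s → A (first k≤m s) j ≈ sum (λ l → B (first k≤m l) j * A (first k≤m s) (first k≤n l))
    top-relation j s = trans (column-relation A k d k≤m k≤n (first k≤m s) j)
      (trans (+-congˡ (residual-> B (first k≤m s) j
        (≡.subst (ℕ._< k) (≡.sym (toℕ-inject≤ s k≤m)) (toℕ<n s)))) (+-identityʳ _))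

    lower-minor : ∀ i j → k ℕ.≤ toℕ i →
      minor A (first k≤m ∷ʳ i) (first k≤n ∷ʳ j) ≈ B i j * leadingMinor A k k≤m k≤n
    lower-minor i j k≤i = bordered-minor A (first k≤m) (first k≤n) i j _ (B i j) (top-relation j)
      (trans (column-relation A k d k≤m k≤n i j) (+-congˡ (residual-≤ B i j k≤i)))

  upper-minor : ∀ {m n} (A : Matrix m n) k d .(k≤m : k ℕ.≤ m) .(k≤n : k ℕ.≤ n) (i : Fin k) j →
    minor A (first k≤m) (removeAt (first k≤n ∷ʳ j) (inject₁ i))
      ≈ ε ^ (k ℕ.+ suc (toℕ i)) * (evenStage A k d (first k≤m i) j * leadingMinor A k k≤m k≤n)
  upper-minor A (suc k) d k≤m k≤n i j = begin
    minor A (first k≤m) (removeAt (first k≤n ∷ʳ j) (inject₁ i))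
      ≈⟨ cramer A (first k≤m) (first k≤n) j (λ l → evenStage A (suc k) d (first k≤m l) j)
           (top-relation A (suc k) d k≤m k≤n j) i ⟩
    ε ^ (k ℕ.+ toℕ i) * x
      -- The target exponent is larger by two: `k` is here one less than the number of columns, and
      -- `i` counts from 0. The factor `ε * ε` makes up the difference.
      ≈⟨ *-congʳ (trans (*-congʳ ε*ε≈1) (*-identityˡ _)) ⟨
    ε * ε * ε ^ (k ℕ.+ toℕ i) * x
      ≈⟨ *-congʳ (*-assoc ε ε _) ⟩
    ε * ε ^ suc (k ℕ.+ toℕ i) * x
      ≈⟨ *-congʳ (*-congˡ (reflexive (≡.cong (ε ^_) (ℕₚ.+-suc k (toℕ i))))) ⟨
    ε * ε ^ (k ℕ.+ suc (toℕ i)) * x ∎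
    where
    x : Carrier
    x = evenStage A (suc k) d (first k≤m i) j * leadingMinor A (suc k) k≤m k≤n

  -- This presents the leading minor of order `suc k` as the one of order `k` bordered at the pivot
  -- position, so that `lower-minor` applies.
  first-∷ʳ : ∀ {k m} .(k<m : k ℕ.< m) .(k≤m : k ℕ.≤ m) → first k<m ≗ first k≤m ∷ʳ fromℕ< k<m
  first-∷ʳ {zero}  {suc m} k<m k≤m zero    = ≡.refl
  first-∷ʳ {suc k} {suc m} k<m k≤m zero    = ≡.refl
  first-∷ʳ {suc k} {suc m} k<m k≤m (suc s) =
    ≡.trans (≡.cong suc (first-∷ʳ (ℕ.s≤s⁻¹ k<m) (ℕ.s≤s⁻¹ k≤m) s)) (map-∷ʳ (first (ℕ.s≤s⁻¹ k≤m)) s)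
    where
    map-∷ʳ : ∀ {k m} (xs : Vector (Fin m) k) {x} → ∀ s → suc ((xs ∷ʳ x) s) ≡ (suc ∘ xs ∷ʳ suc x) s
    map-∷ʳ xs = ∷ʳ-pairs (λ u v → suc u ≡ v) xs (suc ∘ xs) (λ _ → ≡.refl) ≡.refl

  -- Each leading minor is the pivot times the previous one, so it is the product of the pivots so
  -- far, starting from the empty determinant 1.
  leadingMinor#0 : ∀ {m n} (A : Matrix m n) k (d : Defined A k) .(k≤m : k ℕ.≤ m) .(k≤n : k ℕ.≤ n) →
                   leadingMinor A k k≤m k≤n # 0#
  leadingMinor#0 A zero    d         k≤m k≤n = 1#0
  leadingMinor#0 {m} {n} A (suc k) (d , piv) k<m′ k<n′ =
    #-congʳ (sym pivotal) (x#0y#0→xy#0 pivot#0 (leadingMinor#0 A k d k≤m k≤n))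
    where
    open HasPivot piv
    k≤m : k ℕ.≤ m
    k≤m = ℕₚ.<⇒≤ k<m
    k≤n : k ℕ.≤ n
    k≤n = ℕₚ.<⇒≤ k<n
    pivotal : leadingMinor A (suc k) k<m k<n ≈ evenStage A k d row col * leadingMinor A k k≤m k≤n
    pivotal = trans (minor-cong A (first-∷ʳ k<m k≤m) (first-∷ʳ k<n k≤n))
      (lower-minor A k d k≤m k≤n row col (ℕₚ.≤-reflexive (≡.sym (toℕ-fromℕ< k<m))))

  quotient-* : ∀ x y y#0 → quotient (x * y) y y#0 ≈ x
  quotient-* x y y#0 = trans (*-assoc x y _) (trans (*-congˡ (*-reciprocal y y#0)) (*-identityʳ x))

theorem2p6 : ∀ {c ℓ₁ ℓ₂ ℓ₃} (ℝ : RealNumbers c ℓ₁ ℓ₂ ℓ₃) → let open Matrices (RealNumbers.heytingField ℝ) in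
    ∀ {m n} (A : Matrix m n) (r : ℕ) → HasRank A r → 1 ℕ.< r →
    (elim : DiagonallyEliminable A r) →
    (k : ℕ) (k<r : k ℕ.< r) →
    let open DiagonallyEliminable elim
        k≤m = k≤rows k<r
        k≤n = k≤cols k<r
        A⁽²ᵏ⁾ = evenStage A k (defined k<r)
        mₖ = leadingMinor A k k≤m k≤n
    in
    (∀ (i : Fin m) (j : Fin k) →
       A⁽²ᵏ⁾ i (inject≤ j k≤n) ≈ identity m i (inject≤ j k≤m))
    ×
    (Σ[ mₖ#0 ∈ mₖ # 0# ]
       (∀ (j : Fin n) → k ℕ.≤ toℕ j →
          (∀ (i : Fin k) →
             A⁽²ᵏ⁾ (inject≤ i k≤m) j
               ≈ (- 1#) ^ (k ℕ.+ suc (toℕ i))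
                 * quotient (minor A (first k≤m) (removeAt (first k≤n ∷ʳ j) (inject₁ i))) mₖ mₖ#0)
          ×
          (∀ (i : Fin m) → k ℕ.≤ toℕ i →
             A⁽²ᵏ⁾ i j
               ≈ quotient (minor A (first k≤m ∷ʳ i) (first k≤n ∷ʳ j)) mₖ mₖ#0)))
theorem2p6 ℝ {m} {n} A r _ _ elim k k<r =
  (λ i j → identity-columns F A k d i (inject≤ j k≤n) (inject≤ j k≤m)
    (≡.trans (toℕ-inject≤ j k≤n) (≡.sym (toℕ-inject≤ j k≤m)))
    (≡.subst (ℕ._< k) (≡.sym (toℕ-inject≤ j k≤n)) (toℕ<n j))) ,
  mₖ#0 , λ j _ → (λ i → upper i j) , λ i k≤i → lower i j k≤i
  where
  F = RealNumbers.heytingField ℝ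
  open Matrices F
  open CommutativeRing commutativeRing using (sym; trans; *-congˡ; *-congʳ; *-assoc; *-identityˡ; setoid)
  open SetoidReasoning setoid
  open DiagonallyEliminable elim using (defined; k≤rows; k≤cols)
  d   = defined k<r
  k≤m = k≤rows k<r
  k≤n = k≤cols k<r
  mₖ   = leadingMinor A k k≤m k≤n
  mₖ#0 = leadingMinor#0 F A k d k≤m k≤n
  B    = evenStage A k d

  lower : ∀ i j → k ℕ.≤ toℕ i → B i j ≈ quotient (minor A (first k≤m ∷ʳ i) (first k≤n ∷ʳ j)) mₖ mₖ#0
  lower i j k≤i = trans (sym (quotient-* F (B i j) mₖ mₖ#0))
    (*-congʳ (sym (lower-minor F A k d k≤m k≤n i j k≤i)))

  upper : ∀ i j → B (inject≤ i k≤m) j ≈ (- 1#) ^ (k ℕ.+ suc (toℕ i))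
          * quotient (minor A (first k≤m) (removeAt (first k≤n ∷ʳ j) (inject₁ i))) mₖ mₖ#0
  upper i j = begin
    b                                    ≈⟨ quotient-* F b mₖ mₖ#0 ⟨
    quotient (b * mₖ) mₖ mₖ#0            ≈⟨ *-identityˡ _ ⟨
    -- Of the two signs in `e * e`, one stays as the sign of the claim and the other turns `b * mₖ`
    -- into the minor by `upper-minor`.
    1# * quotient (b * mₖ) mₖ mₖ#0       ≈⟨ *-congʳ (ε^n*ε^n≈1 F (k ℕ.+ suc (toℕ i))) ⟨
    e * e * quotient (b * mₖ) mₖ mₖ#0    ≈⟨ *-assoc e e _ ⟩
    e * (e * quotient (b * mₖ) mₖ mₖ#0)  ≈⟨ *-congˡ (*-assoc e (b * mₖ) _) ⟨
    e * quotient (e * (b * mₖ)) mₖ mₖ#0  ≈⟨ *-congˡ (*-congʳ (upper-minor F A k d k≤m k≤n i j)) ⟨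
    _                                    ∎
    where
    b = B (inject≤ i k≤m) j
    e = (- 1#) ^ (k ℕ.+ suc (toℕ i))
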